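{- For every $n \geq 0$, the number of upper zigzag paths in $P(n,n)$ equals the odd-indexed Fibonacci number $f_{2n+1}$.
   Context: The Fibonacci sequence is defined by $f_0 = 0$, $f_1 = 1$, $f_{n+2} = f_{n+1} + f_n$. $P(n,n)$ denotes the set of words $w \in \{x,y\}^{*}$ with exactly $n$ occurrences of $x$ and $n$ occurrences of $y$, identified with lattice paths from $(0,0)$ to $(n,n)$ where $x$ is a unit East step and $y$ is a unit North step. If $w = w_0 w_1$ where $w_0$ ends with $y$ and $w_1$ begins with $x$, then $w$ has a North-East turn at the point $(a,b)$, where $a$ and $b$ are the numbers of $x$'s and $y$'s in $w_0$; if $w_0$ ends with $x$ and $w_1$ begins with $y$, then $w$ has an East-North turn at the point $(a,b)$, defined in the same way. A path is an upper zigzag if each of its North-East turns is above the line $y = x + \frac12$ and each of its East-North turns is below this line; equivalently, every North-East turn $(a,b)$ satisfies $a < b$ and every East-North turn $(a,b)$ satisfies $b \leq a$. -}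

module Defs where

open import Data.Fin.Base using (Fin)
open import Data.Integer.Base using (+_)
open import Data.List.Base using (List; _++_; filter; head; last; length)
open import Data.Maybe.Base using (just)
open import Data.Nat.Base using (ℕ; suc; _+_)
open import Data.Product.Base using (Σ; ∃₂; _×_; proj₁)
open import Data.Rational.Unnormalised.Base as ℚᵘ using (ℚᵘ; ½)
open import Function.Bundles using (Bijection)
open import Level using (Level)
open import Relation.Binary.Construct.On as On using ()
open import Relation.Binary.Definitions using (DecidableEquality)
open import Relation.Binary.PropositionalEquality using (_≡_; refl; setoid)
open import Relation.Nullary.Decidable.Core using (yes; no)
open import Relation.Unary using (Pred)

private
  variable
    a p : Level

fib : ℕ → ℕ
fib 0             = 0
fib 1             = 1
fib (suc (suc n)) = fib (suc n) + fib n

-- x is a unit East step, y a unit North step.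
data Letter : Set where
  x y : Letter

_≟_ : DecidableEquality Letter
x ≟ x = yes refl
x ≟ y = no λ ()
y ≟ x = no λ ()
y ≟ y = yes refl

Word : Set
Word = List Letter

occurrences : Letter → Word → ℕ
occurrences c w = length (filter (c ≟_) w)

P : ℕ → ℕ → Pred Word _
P m n w = occurrences x w ≡ m × occurrences y w ≡ n

-- w has a turn at (i , j) where a step c is immediately followed by a step d.
TurnAt : Letter → Letter → Word → ℕ → ℕ → Set
TurnAt c d w i j = ∃₂ λ w₀ w₁ →
  w ≡ w₀ ++ w₁ × last w₀ ≡ just c × head w₁ ≡ just d ×
  occurrences x w₀ ≡ i × occurrences y w₀ ≡ j

NorthEastTurn EastNorthTurn : Word → ℕ → ℕ → Set
NorthEastTurn = TurnAt y x
EastNorthTurn = TurnAt x y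

fromℕ : ℕ → ℚᵘ
fromℕ n = + n ℚᵘ./ 1

-- Position of the point (i , j) relative to the line of equation y = x + ½.
AboveLine BelowLine : ℕ → ℕ → Set
AboveLine i j = fromℕ i ℚᵘ.+ ½ ℚᵘ.< fromℕ j
BelowLine i j = fromℕ j ℚᵘ.< fromℕ i ℚᵘ.+ ½

UpperZigzag : Pred Word _
UpperZigzag w =
  (∀ i j → NorthEastTurn w i j → AboveLine i j) ×
  (∀ i j → EastNorthTurn w i j → BelowLine i j)

-- Exactly k elements of A satisfy Q.  Elements of Σ A Q are compared by their
-- first components only, so that different proofs of Q are not counted apart.
HasCardinality : {A : Set a} → Pred A p → ℕ → Set _
HasCardinality {A = A} Q k =
  Bijection (setoid (Fin k)) (On.setoid {B = Σ A Q} (setoid A) proj₁)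

{-# OPTIONS --safe #-}
-- Let a turn be judged by the numbers i, j of steps x, y still to come: a path
-- in P(n,n) is an upper zigzag iff i ≤ j at its East-North turns and j < i at
-- its North-East turns.  By induction, a path can be completed in f(2min(i,j)+1)
-- ways after a step x, and in f(2min(i-1,j)+2) ways after a step y if i > 0.
-- The first formula answers the question, because putting an x in front of an
-- upper zigzag creates no forbidden turn.
module Submission where

open import Defs
open import Data.Nat.Base using (ℕ; _+_; _*_)
open import Relation.Unary using (_∩_)

open import Data.Fin.Base using (zero; suc)
open import Data.Integer.Base as ℤ using (+_)
import Data.Integer.Properties as ℤ
open import Data.List.Base using (List; []; _∷_; _++_; map; filter; head; last; length; lookup)
open import Data.List.Membership.Propositional using (_∈_)
open import Data.List.Membership.Propositional.Properties
  using (∈-map⁺; ∈-map⁻; ∈-++⁺ˡ; ∈-++⁺ʳ; ∈-++⁻; ∈-lookup)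
open import Data.List.Properties
  using (filter-++; length-++; length-map; ∷-injectiveˡ; ∷-injectiveʳ)
open import Data.List.Relation.Unary.All as All using ()
open import Data.List.Relation.Unary.AllPairs using ([]; _∷_)
open import Data.List.Relation.Unary.Any using (here; there; index)
open import Data.List.Relation.Unary.Any.Properties using (lookup-index)
open import Data.List.Relation.Unary.Unique.Propositional using (Unique)
import Data.List.Relation.Unary.Unique.Propositional.Properties as Unique
open import Data.Maybe.Base using (just)
open import Data.Nat.Base using (zero; suc; _≤_; _<_; _⊓_; z≤n; s≤s; s≤s⁻¹)
open import Data.Nat.Properties hiding (_≟_)
open import Data.Product.Base using (_×_; _,_; proj₁; proj₂)
open import Data.Rational.Unnormalised.Base using (*<*)
open import Data.Rational.Unnormalised.Properties using (drop-*<*)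
open import Data.Sum.Base using (inj₁; inj₂)
open import Data.Unit.Base using (⊤; tt)
open import Function.Base using (_∘_)
open import Function.Bundles using (_⇔_; mk⇔; Equivalence)
open import Function.Construct.Composition using (_⇔-∘_)
open import Level using (0ℓ)
open import Relation.Binary.PropositionalEquality
  using (_≡_; refl; sym; trans; cong; cong₂; subst; subst₂)
open import Relation.Nullary.Decidable.Core using (yes; no)
open import Relation.Nullary.Negation using (¬_; contradiction)
open import Relation.Unary using (Pred)

open Equivalence using (to; from)

private
  variable
    c d : Letter
    i j k l n : ℕ
    w : Word

-- Counting words

lookup-injective : {ws : List Word} → Unique ws →
                   ∀ {p q} → lookup ws p ≡ lookup ws q → p ≡ q
lookup-injective (_  ∷ _)   {zero}  {zero}  _  = refl
lookup-injective (w∉ ∷ _)   {zero}  {suc q} eq = contradiction eq (All.lookup w∉ (∈-lookup q))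
lookup-injective (w∉ ∷ _)   {suc p} {zero}  eq = contradiction (sym eq) (All.lookup w∉ (∈-lookup p))
lookup-injective (_  ∷ ws!) {suc p} {suc q} eq = cong suc (lookup-injective ws! eq)

-- Explicit duplicate-free lists make counts additive, since lists of disjoint classes can be
-- concatenated. The bijection with `Fin k` is needed only once, at the end.
record Count (Q : Pred Word 0ℓ) (k : ℕ) : Set where
  constructor counted
  field
    words   : List Word
    size    : length words ≡ k
    unique  : Unique words
    members : ∀ {w} → w ∈ words ⇔ Q w

module _ {Q : Pred Word 0ℓ} where

  count⇒cardinality : Count Q k → HasCardinality Q k
  count⇒cardinality (counted ws refl unique members) = record
    { to        = λ p → lookup ws p , to members (∈-lookup p)
    ; cong      = cong (lookup ws)
    ; bijective = lookup-injective unique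
                , λ (_ , q) → let w∈ws = from members q in
                    index w∈ws , λ { refl → sym (lookup-index w∈ws) }
    }

  count-cong : {R : Pred Word 0ℓ} → (∀ {w} → Q w ⇔ R w) → Count Q k → Count R k
  count-cong Q⇔R (counted ws size unique members) =
    counted ws size unique (Q⇔R ⇔-∘ members)

  count-∅ : (∀ {w} → ¬ Q w) → Count Q 0
  count-∅ ¬Q = counted [] refl [] (mk⇔ (λ ()) (λ q → contradiction q ¬Q))

  count-[] : (∀ {w} → w ≡ [] ⇔ Q w) → Count Q 1
  count-[] only = counted ([] ∷ []) refl (All.[] ∷ [])
    (mk⇔ (λ { (here eq) → to only eq ; (there ()) }) (here ∘ from only))

  -- Splitting by first letter gives two disjoint classes. Applied to completions, the sum `k + l`
  -- becomes the Fibonacci recurrence.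
  count-∷ : ¬ Q [] → Count (Q ∘ (x ∷_)) k → Count (Q ∘ (y ∷_)) l → Count Q (k + l)
  count-∷ ¬Q[] (counted us refl us! us⇔) (counted vs refl vs! vs⇔) = counted
    (map (x ∷_) us ++ map (y ∷_) vs)
    (trans (length-++ (map (x ∷_) us))
           (cong₂ _+_ (length-map (x ∷_) us) (length-map (y ∷_) vs)))
    (Unique.++⁺ (Unique.map⁺ ∷-injectiveʳ us!) (Unique.map⁺ ∷-injectiveʳ vs!) disjoint)
    (mk⇔ sound (complete _))
    where
    disjoint : ∀ {w} → ¬ (w ∈ map (x ∷_) us × w ∈ map (y ∷_) vs)
    disjoint (p , q) with _ , _ , refl ← ∈-map⁻ (x ∷_) p | _ , _ , () ← ∈-map⁻ (y ∷_) q

    sound : ∀ {w} → w ∈ map (x ∷_) us ++ map (y ∷_) vs → Q w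
    sound p with ∈-++⁻ (map (x ∷_) us) p
    ... | inj₁ q with _ , r , refl ← ∈-map⁻ (x ∷_) q = to us⇔ r
    ... | inj₂ q with _ , r , refl ← ∈-map⁻ (y ∷_) q = to vs⇔ r

    complete : ∀ w → Q w → w ∈ map (x ∷_) us ++ map (y ∷_) vs
    complete []      q = contradiction q ¬Q[]
    complete (x ∷ w) q = ∈-++⁺ˡ (∈-map⁺ (x ∷_) (from us⇔ q))
    complete (y ∷ w) q = ∈-++⁺ʳ (map (x ∷_) us) (∈-map⁺ (y ∷_) (from vs⇔ q))

-- Completions

-- The remaining steps i, j of types x, y include the step d itself.
Allowed : Letter → Letter → ℕ → ℕ → Set
Allowed x y i j = i ≤ j
Allowed y x i j = j < i
Allowed x x i j = ⊤
Allowed y y i j = ⊤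

-- Here `c` is the step just taken, and `i`, `j` count the steps x, y still to come. Each
-- constructor checks only the junction of `c` with the next step.
data Completion : Letter → ℕ → ℕ → Word → Set where
  end   : Completion c 0 0 []
  east  : Allowed c x (suc i) j → Completion x i j w → Completion c (suc i) j (x ∷ w)
  north : Allowed c y i (suc j) → Completion y i j w → Completion c i (suc j) (y ∷ w)

count-end : Count (Completion c 0 0) 1
count-end = count-[] (mk⇔ (λ { refl → end }) (λ { end → refl }))

count-east : Allowed c x (suc i) j → Count (Completion x i j) k →
             Count (Completion c (suc i) j ∘ (x ∷_)) k
count-east a = count-cong (mk⇔ (east a) (λ { (east _ p) → p }))

count-north : Allowed c y i (suc j) → Count (Completion y i j) k →
              Count (Completion c i (suc j) ∘ (y ∷_)) k
count-north a = count-cong (mk⇔ (north a) (λ { (north _ p) → p }))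

count-east-none : ¬ Allowed c x i j → Count (Completion c i j ∘ (x ∷_)) 0
count-east-none ¬a = count-∅ λ { (east a _) → ¬a a }

count-north-none : ¬ Allowed c y i j → Count (Completion c i j ∘ (y ∷_)) 0
count-north-none ¬a = count-∅ λ { (north a _) → ¬a a }

-- The case left out of `count-after-y`: with no x to come, its formula would give f(0) = 0, yet the
-- word of j letters y is a completion.
count-only-north : ∀ j → Count (Completion y 0 j) 1
count-only-north zero    = count-end
count-only-north (suc j) =
  count-∷ (λ ()) (count-∅ λ ()) (count-north tt (count-only-north j))

fib-odd-suc : ∀ m → fib (suc (2 * m)) + fib (2 + 2 * m) ≡ fib (suc (2 * suc m))
fib-odd-suc m =
  trans (+-comm (fib (suc (2 * m))) _) (cong (λ k → fib (suc k)) (sym (*-suc 2 m)))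

fib-even-suc : ∀ m → fib (suc (2 * suc m)) + fib (2 + 2 * m) ≡ fib (2 + 2 * suc m)
fib-even-suc m = cong (λ k → fib (suc (2 * suc m)) + fib k) (sym (*-suc 2 m))

-- Simultaneous induction: every recursive call has one step fewer to come.
count-after-x : ∀ i j → Count (Completion x i j) (fib (suc (2 * (i ⊓ j))))
count-after-y : ∀ i j → Count (Completion y (suc i) j) (fib (2 + 2 * (i ⊓ j)))

count-after-x zero    zero    = count-end
count-after-x zero    (suc j) =
  count-∷ (λ ()) (count-∅ λ ()) (count-north z≤n (count-only-north j))
count-after-x (suc i) zero    with count-after-x i zero
... | east-count rewrite ⊓-zeroʳ i =
  count-∷ (λ ()) (count-east tt east-count) (count-∅ λ ())
count-after-x (suc i) (suc j) with i ≤? j | count-after-x i (suc j) | count-after-y i j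
-- Both continuations are open and both minima equal i: f(2i+1) + f(2i+2) = f(2i+3).
... | yes i≤j | east-count | north-count
  rewrite m≤n⇒m⊓n≡m (m≤n⇒m≤1+n i≤j) | m≤n⇒m⊓n≡m i≤j =
  subst (Count _) (fib-odd-suc i)
    (count-∷ (λ ()) (count-east tt east-count) (count-north (s≤s i≤j) north-count))
-- The turn is forbidden, so x is forced. Since j < i, dropping this x leaves the minimum at j+1.
... | no i≰j  | east-count | _
  rewrite m≥n⇒m⊓n≡n (≰⇒> i≰j) | m≥n⇒m⊓n≡n (≰⇒≥ i≰j) =
  subst (Count _) (+-identityʳ _)
    (count-∷ (λ ()) (count-east tt east-count) (count-north-none (i≰j ∘ s≤s⁻¹)))

count-after-y i zero    with count-after-x i zero
... | east-count rewrite ⊓-zeroʳ i =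
  count-∷ (λ ()) (count-east (s≤s z≤n) east-count) (count-∅ λ ())
count-after-y i (suc j) with suc j ≤? i | count-after-x i (suc j) | count-after-y i j
-- Both continuations are open, with minima j+1 and j: f(2j+3) + f(2j+2) = f(2j+4).
... | yes j<i | east-count | north-count
  rewrite m≥n⇒m⊓n≡n j<i | m≥n⇒m⊓n≡n (<⇒≤ j<i) =
  subst (Count _) (fib-even-suc j)
    (count-∷ (λ ()) (count-east (s≤s j<i) east-count) (count-north tt north-count))
-- Now y is forced. Since i ≤ j, dropping it leaves the minimum at i.
... | no j≮i  | _          | north-count
  rewrite m≤n⇒m⊓n≡m (m≤n⇒m≤1+n (≮⇒≥ j≮i)) | m≤n⇒m⊓n≡m (≮⇒≥ j≮i) =
  count-∷ (λ ()) (count-east-none (j≮i ∘ s≤s⁻¹)) (count-north tt north-count)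

-- Upper zigzags as completions

-- Measuring the suffix `w₁` instead of the prefix makes the condition survive the removal of a
-- first letter, which the recursion on words requires.
TurnsAllowed : Word → Set
TurnsAllowed w = ∀ w₀ w₁ c d → w ≡ w₀ ++ w₁ → last w₀ ≡ just c → head w₁ ≡ just d →
  Allowed c d (occurrences x w₁) (occurrences y w₁)

turnsAllowed-tail : TurnsAllowed (c ∷ d ∷ w) → TurnsAllowed (d ∷ w)
turnsAllowed-tail         t []       w₁ e f eq () h
turnsAllowed-tail {c = c} t (b ∷ w₀) w₁ e f eq lt h =
  t (c ∷ b ∷ w₀) w₁ e f (cong (c ∷_) eq) lt h

completion⇒P : Completion c i j w → P i j w
completion⇒P end         = refl , refl
completion⇒P (east _ p)  with refl , refl ← completion⇒P p = refl , refl
completion⇒P (north _ p) with refl , refl ← completion⇒P p = refl , refl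

completion⇒turnsAllowed : Completion c i j w → TurnsAllowed (c ∷ w)
completion⇒turnsAllowed p [] w₁ _ _ _ () _
-- The split falls just before the first step of the completion, so `a` is the claim once the
-- indices are identified with occurrence counts.
completion⇒turnsAllowed p@(east a _) (_ ∷ []) w₁ _ _ refl refl refl
  with refl , refl ← completion⇒P p = a
completion⇒turnsAllowed p@(north a _) (_ ∷ []) w₁ _ _ refl refl refl
  with refl , refl ← completion⇒P p = a
completion⇒turnsAllowed (east _ p) (_ ∷ b ∷ w₀) w₁ e f eq lt h =
  completion⇒turnsAllowed p (b ∷ w₀) w₁ e f (∷-injectiveʳ eq) lt h
completion⇒turnsAllowed (north _ p) (_ ∷ b ∷ w₀) w₁ e f eq lt h =
  completion⇒turnsAllowed p (b ∷ w₀) w₁ e f (∷-injectiveʳ eq) lt h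

turnsAllowed⇒completion : ∀ w → TurnsAllowed (c ∷ w) →
                          Completion c (occurrences x w) (occurrences y w) w
turnsAllowed⇒completion []      t = end
turnsAllowed⇒completion (x ∷ w) t =
  east (t (_ ∷ []) (x ∷ w) _ x refl refl refl)
       (turnsAllowed⇒completion w (turnsAllowed-tail t))
turnsAllowed⇒completion (y ∷ w) t =
  north (t (_ ∷ []) (y ∷ w) _ y refl refl refl)
        (turnsAllowed⇒completion w (turnsAllowed-tail t))

-- Cross-multiplying turns the comparison of fractions into 2i+1 < 2j; `lhs` and `rhs` tidy the two
-- integer products.
aboveLine⇔< : AboveLine i j ⇔ i < j
aboveLine⇔< {i} {j} = mk⇔
  (λ p → *-cancelʳ-< 2 i j (<-trans (≤-reflexive (+-comm 1 (i * 2)))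
    (ℤ.drop‿+<+ (subst₂ ℤ._<_ lhs rhs (drop-*<* p)))))
  (λ i<j → *<* (subst₂ ℤ._<_ (sym lhs) (sym rhs) (ℤ.+<+
    (≤-trans (≤-reflexive (cong suc (+-comm (i * 2) 1))) (*-monoˡ-≤ 2 i<j)))))
  where
  lhs : (+ i ℤ.* + 2 ℤ.+ + 1) ℤ.* + 1 ≡ + (i * 2 + 1)
  lhs = trans (ℤ.*-identityʳ _) (cong (ℤ._+ + 1) (sym (ℤ.pos-* i 2)))
  rhs : + j ℤ.* + 2 ≡ + (j * 2)
  rhs = sym (ℤ.pos-* j 2)

-- The cleared form is 2j < 2i+1, that is 2j ≤ 2i.
belowLine⇔≥ : BelowLine i j ⇔ j ≤ i
belowLine⇔≥ {i} {j} = mk⇔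
  (λ p → *-cancelʳ-≤ j i 2 (s≤s⁻¹ (≤-trans
    (ℤ.drop‿+<+ (subst₂ ℤ._<_ lhs rhs (drop-*<* p))) (≤-reflexive (+-comm (i * 2) 1)))))
  (λ j≤i → *<* (subst₂ ℤ._<_ (sym lhs) (sym rhs) (ℤ.+<+
    (≤-trans (s≤s (*-monoˡ-≤ 2 j≤i)) (≤-reflexive (+-comm 1 (i * 2)))))))
  where
  lhs : + j ℤ.* + 2 ≡ + (j * 2)
  lhs = sym (ℤ.pos-* j 2)
  rhs : (+ i ℤ.* + 2 ℤ.+ + 1) ℤ.* + 1 ≡ + (i * 2 + 1)
  rhs = trans (ℤ.*-identityʳ _) (cong (ℤ._+ + 1) (sym (ℤ.pos-* i 2)))

-- Translates between steps taken and steps to come: both letters have the same total, so the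
-- comparison reverses.
≤-complement : i + k ≡ j + l → i ≤ j → l ≤ k
≤-complement eq i≤j = ≮⇒≥ λ k<l → <⇒≢ (+-mono-≤-< i≤j k<l) eq

<-complement : i + k ≡ j + l → i < j → l < k
<-complement eq i<j = ≰⇒> λ k≤l → <⇒≢ (+-mono-<-≤ i<j k≤l) eq

occurrences-++ : ∀ c v w → occurrences c (v ++ w) ≡ occurrences c v + occurrences c w
occurrences-++ c v w =
  trans (cong length (filter-++ (c ≟_) v w)) (length-++ (filter (c ≟_) v))

balanced-++ : ∀ v w → P n n (v ++ w) →
  occurrences x v + occurrences x w ≡ occurrences y v + occurrences y w
balanced-++ v w (px , py) =
  trans (sym (occurrences-++ x v w)) (trans px (trans (sym py) (occurrences-++ y v w)))

upperZigzag⇒turnsAllowed : P n n w → UpperZigzag w → TurnsAllowed (x ∷ w)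
upperZigzag⇒turnsAllowed _ _ []      _  _ _ _ () _
upperZigzag⇒turnsAllowed _ _ _       _  x x _ _ _ = tt
upperZigzag⇒turnsAllowed _ _ _       _  y y _ _ _ = tt
-- The turn created by the prepended x, when the path starts with y: n steps of each kind are to
-- come, and n ≤ n.
upperZigzag⇒turnsAllowed (px , py) _ (_ ∷ []) _ x y refl _ _ =
  ≤-reflexive (trans px (sym py))
upperZigzag⇒turnsAllowed _ _ (_ ∷ []) _ y x refl () _
-- Removing the prepended x from a longer prefix exhibits a turn of the path itself.
upperZigzag⇒turnsAllowed pw (_ , en) (_ ∷ b ∷ v) w x y refl lt h =
  ≤-complement (sym (balanced-++ (b ∷ v) w pw))
    (to belowLine⇔≥ (en _ _ (b ∷ v , w , refl , lt , h , refl , refl)))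
upperZigzag⇒turnsAllowed pw (ne , _) (_ ∷ b ∷ v) w y x refl lt h =
  <-complement (balanced-++ (b ∷ v) w pw)
    (to aboveLine⇔< (ne _ _ (b ∷ v , w , refl , lt , h , refl , refl)))

last-∷ : ∀ v → last v ≡ just d → last (c ∷ v) ≡ just d
last-∷ (_ ∷ _) eq = eq

-- Prepending x to the prefix keeps its last letter and the suffix. The complement is then taken
-- from suffix to prefix, hence `swap`.
turnsAllowed⇒upperZigzag : P n n w → TurnsAllowed (x ∷ w) → UpperZigzag w
turnsAllowed⇒upperZigzag pw t =
  (λ { _ _ (v , w , refl , lt , h , refl , refl) → from aboveLine⇔<
       (<-complement (swap (occurrences y w) (occurrences x w) (sym (balanced-++ v w pw)))
         (t (x ∷ v) w y x refl (last-∷ v lt) h)) }) ,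
  (λ { _ _ (v , w , refl , lt , h , refl , refl) → from belowLine⇔≥
       (≤-complement (swap (occurrences x w) (occurrences y w) (balanced-++ v w pw))
         (t (x ∷ v) w x y refl (last-∷ v lt) h)) })
  where
  swap : ∀ k l → i + k ≡ j + l → k + i ≡ l + j
  swap k l eq = trans (+-comm k _) (trans eq (+-comm _ l))

completion⇔upperZigzag : Completion x n n w ⇔ (P n n ∩ UpperZigzag) w
completion⇔upperZigzag = mk⇔
  (λ p → let pw = completion⇒P p in
    pw , turnsAllowed⇒upperZigzag pw (completion⇒turnsAllowed p))
  (λ (pw , z) → subst₂ (λ i j → Completion x i j _) (proj₁ pw) (proj₂ pw)
    (turnsAllowed⇒completion _ (upperZigzag⇒turnsAllowed pw z)))

mainTheorem3 : ∀ (n : ℕ) → HasCardinality (P n n ∩ UpperZigzag) (fib (2 * n + 1))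
mainTheorem3 n = count⇒cardinality
  (subst (Count _) 2[n⊓n]+1 (count-cong completion⇔upperZigzag (count-after-x n n)))
  where
  2[n⊓n]+1 : fib (suc (2 * (n ⊓ n))) ≡ fib (2 * n + 1)
  2[n⊓n]+1 = cong fib (trans (cong (λ m → suc (2 * m)) (⊓-idem n)) (+-comm 1 (2 * n)))
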